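{- Let $(G,\beta)$ be an edge-labeled graph on vertices $v_1,\dots,v_n$, with module $M_v=m_v\mathbb{Z}$ at each vertex $v$ and module $\mathbb{Z}/r_{uv}\mathbb{Z}$ at each edge $uv$, and for each $i=1,\dots,n$ let $F^{(i)}=(0,\dots,0,f^{(i)}_{v_i},\dots,f^{(i)}_{v_n})$ be an $i$-th flow-up class on $(G,\beta)$. The following are equivalent: (1) The set $\{F^{(1)},\dots,F^{(n)}\}$ forms a module basis (over $\mathbb{Z}$) for $\hat{R}_G$. (2) For each $i\in\{1,\dots,n\}$ and each flow-up class $A^{(i)}=(0,\dots,0,g_{v_i},\dots,g_{v_n})\in\hat{\mathcal{F}}_i$, the entry $g_{v_i}$ is a multiple of the entry $f^{(i)}_{v_i}$.
   Context: Setting: $G=(V,E)$ is a finite graph with ordered vertex set $V=\{v_1,\dots,v_n\}$, whose edges are unordered pairs $uv$ of distinct vertices. Each vertex $v$ is assigned the $\mathbb{Z}$-module $M_v=m_v\mathbb{Z}$ ($m_v\in\mathbb{Z}$), each edge $uv$ is assigned the $\mathbb{Z}$-module $\beta(uv)=\mathbb{Z}/r_{uv}\mathbb{Z}$ ($r_{uv}\in\mathbb{Z}$), and for each vertex $v$ incident to an edge $e$ the map $\varphi_v:M_v\to\mathbb{Z}/r_e\mathbb{Z}$ is $a\mapsto a+r_e\mathbb{Z}$. The pair $(G,\beta)$ is called an edge-labeled graph. An (extending generalized) spline on $(G,\beta)$ is a tuple $(f_{v_1},\dots,f_{v_n})\in\prod_i m_{v_i}\mathbb{Z}$ with $f_u\equiv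 f_v \pmod{r_{uv}}$ for every edge $uv$. The $\mathbb{Z}$-module of all splines is $\hat{R}_G$. An $i$-th flow-up class is a spline with $f_{v_i}\neq 0$ and $f_{v_s}=0$ for all $s<i$; the set of all $i$-th flow-up classes is $\hat{\mathcal{F}}_i$. -}

module Defs where

open import Algebra.Bundles using (Ring)
open import Algebra.Module.Bundles using (LeftModule)
import Algebra.Definitions.RawMonoid as RawMonoidDefs
open import Data.Bool.Base using (Bool; T)
open import Data.Fin.Base using (Fin; _<_)
open import Data.Integer.Base using (ℤ; 0ℤ; _+_; _*_; -_; _-_)
import Data.Integer.Properties as ℤₚ
open import Data.Integer.Divisibility.Signed
  using (_∣_; ∣m∣n⇒∣m+n; ∣m⇒∣-m; ∣n⇒∣m*n; divides)
open import Data.Integer.Tactic.RingSolver using (solve-∀)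
open import Data.Nat.Base using (ℕ)
open import Data.Product.Base using (_×_; _,_; ∃)
open import Level using (0ℓ; _⊔_)
open import Relation.Binary.PropositionalEquality
  using (_≡_; _≢_; refl; sym; trans; cong; cong₂; subst)
open import Relation.Nullary.Negation using (¬_)
open import Relation.Unary using (Pred)

module _ {r ℓr m ℓm} {R : Ring r ℓr} (M : LeftModule R m ℓm) where

  private
    module R = Ring R
    module M = LeftModule M

  linearCombination : ∀ {k} → (Fin k → R.Carrier) → (Fin k → M.Carrierᴹ) → M.Carrierᴹ
  linearCombination c b = RawMonoidDefs.sum M.+ᴹ-rawMonoid (λ j → c j M.*ₗ b j)

  LinearlyIndependent : ∀ {k} → (Fin k → M.Carrierᴹ) → Set (r ⊔ ℓr ⊔ ℓm)
  LinearlyIndependent {k} b =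
    ∀ (c : Fin k → R.Carrier) →
    linearCombination c b M.≈ᴹ M.0ᴹ → ∀ j → c j R.≈ R.0#

  Spanning : ∀ {k} → (Fin k → M.Carrierᴹ) → Set (r ⊔ m ⊔ ℓm)
  Spanning {k} b =
    ∀ x → ∃ λ (c : Fin k → R.Carrier) → x M.≈ᴹ linearCombination c b

  IsBasis : ∀ {k} → (Fin k → M.Carrierᴹ) → Set (r ⊔ ℓr ⊔ m ⊔ ℓm)
  IsBasis b = LinearlyIndependent b × Spanning b

-- A finite simple graph on the ordered vertex set Fin n. An unordered edge uv
-- appears as both (u , v) and (v , u). Adjacency is Bool-valued so that E is a
-- finite set and each pair carries at most one edge.
record Graph (n : ℕ) : Set where
  field
    adjacent : Fin n → Fin n → Bool

  Edge : Fin n → Fin n → Set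
  Edge u v = T (adjacent u v)

  field
    symmetric   : ∀ u v → Edge u v → Edge v u
    irreflexive : ∀ v → ¬ Edge v v

-- (G , β), where β(uv) = ℤ / r_uv ℤ is recorded by the integer label r_uv.
record EdgeLabeledGraph (n : ℕ) : Set where
  field
    graph : Graph n

  open Graph graph public

  field
    label           : ∀ u v → Edge u v → ℤ
    label-symmetric : ∀ u v (e : Edge u v) → label u v e ≡ label v u (symmetric u v e)

_≡_[mod_] : ℤ → ℤ → ℤ → Set
a ≡ b [mod r ] = r ∣ a - b

module _ {n : ℕ} (G : EdgeLabeledGraph n) (m : Fin n → ℤ) where

  open EdgeLabeledGraph G

  -- The integer m v is the generator of the vertex module M_v = m_v ℤ.
  record Spline : Set where
    field
      entry     : Fin n → ℤ
      entry-∈   : ∀ v → m v ∣ entry v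
      congruent : ∀ u v (e : Edge u v) → entry u ≡ entry v [mod label u v e ]

open Spline public

module _ {n : ℕ} (G : EdgeLabeledGraph n) (m : Fin n → ℤ) where

  _≈ˢ_ : Spline G m → Spline G m → Set
  f ≈ˢ g = ∀ v → entry f v ≡ entry g v

  _+ˢ_ : Spline G m → Spline G m → Spline G m
  f +ˢ g = record
    { entry     = λ v → entry f v + entry g v
    ; entry-∈   = λ v → ∣m∣n⇒∣m+n (entry-∈ f v) (entry-∈ g v)
    ; congruent = λ u v e →
        subst (_ ∣_) (rearrange (entry f u) (entry f v) (entry g u) (entry g v))
          (∣m∣n⇒∣m+n (congruent f u v e) (congruent g u v e))
    }
    where
    rearrange : ∀ a b c d → (a - b) + (c - d) ≡ (a + c) - (b + d)
    rearrange = solve-∀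

  0ˢ : Spline G m
  0ˢ = record
    { entry     = λ _ → 0ℤ
    ; entry-∈   = λ v → divides 0ℤ refl
    ; congruent = λ u v e → divides 0ℤ refl
    }

  -ˢ_ : Spline G m → Spline G m
  -ˢ f = record
    { entry     = λ v → - entry f v
    ; entry-∈   = λ v → ∣m⇒∣-m (entry-∈ f v)
    ; congruent = λ u v e →
        subst (_ ∣_) (rearrange (entry f u) (entry f v)) (∣m⇒∣-m (congruent f u v e))
    }
    where
    rearrange : ∀ a b → - (a - b) ≡ - a - - b
    rearrange = solve-∀

  _*ˢ_ : ℤ → Spline G m → Spline G m
  c *ˢ f = record
    { entry     = λ v → c * entry f v
    ; entry-∈   = λ v → ∣n⇒∣m*n c (entry-∈ f v)
    ; congruent = λ u v e →
        subst (_ ∣_) (rearrange c (entry f u) (entry f v))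
          (∣n⇒∣m*n c (congruent f u v e))
    }
    where
    rearrange : ∀ c a b → c * (a - b) ≡ c * a - c * b
    rearrange = solve-∀

  R̂ : LeftModule ℤₚ.+-*-ring 0ℓ 0ℓ
  R̂ = record
    { Carrierᴹ = Spline G m
    ; _≈ᴹ_ = _≈ˢ_
    ; _+ᴹ_ = _+ˢ_
    ; _*ₗ_ = _*ˢ_
    ; 0ᴹ   = 0ˢ
    ; -ᴹ_  = -ˢ_
    ; isLeftModule = record
      { isLeftSemimodule = record
        { +ᴹ-isCommutativeMonoid = record
          { isMonoid = record
            { isSemigroup = record
              { isMagma = record
                { isEquivalence = record
                  { refl  = λ v → refl
                  ; sym   = λ p v → sym (p v)
                  ; trans = λ p q v → trans (p v) (q v)
                  }
                ; ∙-cong = λ p q v → cong₂ _+_ (p v) (q v)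
                }
              ; assoc = λ f g h v → ℤₚ.+-assoc (entry f v) (entry g v) (entry h v)
              }
            ; identity = (λ f v → ℤₚ.+-identityˡ (entry f v))
                       , (λ f v → ℤₚ.+-identityʳ (entry f v))
            }
          ; comm = λ f g v → ℤₚ.+-comm (entry f v) (entry g v)
          }
        ; isPreleftSemimodule = record
          { *ₗ-cong      = λ p q v → cong₂ _*_ p (q v)
          ; *ₗ-zeroˡ     = λ f v → ℤₚ.*-zeroˡ (entry f v)
          ; *ₗ-distribʳ  = λ f c d v → ℤₚ.*-distribʳ-+ (entry f v) c d
          ; *ₗ-identityˡ = λ f v → ℤₚ.*-identityˡ (entry f v)
          ; *ₗ-assoc     = λ c d f v → ℤₚ.*-assoc c d (entry f v)
          ; *ₗ-zeroʳ     = λ c v → ℤₚ.*-zeroʳ c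
          ; *ₗ-distribˡ  = λ c f g v → ℤₚ.*-distribˡ-+ c (entry f v) (entry g v)
          }
        }
      ; -ᴹ‿cong    = λ p v → cong -_ (p v)
      ; -ᴹ‿inverse = (λ f v → ℤₚ.+-inverseˡ (entry f v))
                   , (λ f v → ℤₚ.+-inverseʳ (entry f v))
      }
    }

  -- The set of i-th flow-up classes.
  𝓕̂ : Fin n → Pred (Spline G m) 0ℓ
  𝓕̂ i f = entry f i ≢ 0ℤ × (∀ s → s < i → entry f s ≡ 0ℤ)

{-# OPTIONS --safe #-}

-- The matrix of entries of F is triangular with nonzero diagonal. Hence if a
-- linear combination of F vanishes before position i, so do its coefficients,
-- and its i-th entry is its i-th coefficient times the leading entry of F i:
-- this gives independence and (1) ⇒ (2). Conversely, under (2) one subtracts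
-- multiples of F 1, F 2, … from a spline, clearing one entry at a time; each
-- remainder is zero or a flow-up class, so the next division is exact.
module Submission where

open import Defs
open import Algebra.Module.Bundles using (LeftModule)
import Algebra.Properties.CommutativeMonoid.Sum as Sum
open import Data.Fin.Base using (Fin; zero; suc; toℕ; fromℕ<; _<_; _≤_)
open import Data.Fin.Induction using (<-wellFounded)
open import Data.Fin.Properties using (_≟_; <-cmp; toℕ<n; toℕ-fromℕ<; toℕ-injective; punchInᵢ≢i)
open import Data.Integer.Base using (ℤ; 0ℤ; _+_; _*_; _-_)
open import Data.Integer.Divisibility.Signed using (_∣_; divides)
import Data.Integer.Properties as ℤₚ
open import Data.Integer.Tactic.RingSolver using (solve-∀)
open import Data.Nat.Base as ℕ using (ℕ)
import Data.Nat.Properties as ℕₚ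
open import Data.Product.Base using (_,_; ∃)
open import Data.Sum.Base using (_⊎_; inj₁; inj₂)
open import Data.Vec.Functional using (replicate; updateAt; removeAt)
open import Data.Vec.Functional.Properties using (updateAt-updates; updateAt-minimal)
open import Function.Base using (const; _∘_)
open import Function.Bundles using (_⇔_; mk⇔)
open import Induction.WellFounded using (Acc; acc)
open import Relation.Binary.Definitions using (tri<; tri≈; tri>)
open import Relation.Binary.PropositionalEquality
open import Relation.Nullary using (yes; no; contradiction)
open import Relation.Unary using (_∈_)

open Sum ℤₚ.+-0-commutativeMonoid using (sum; sum-cong-≗; sum-remove; sum-replicate-zero; ∑-distrib-+)

sum-single : ∀ {n} (t : Fin n → ℤ) i → (∀ j → j ≢ i → t j ≡ 0ℤ) → sum t ≡ t i
sum-single {ℕ.suc n} t i t≡0 = begin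
  sum t                        ≡⟨ sum-remove t ⟩
  t i + sum (removeAt t i)     ≡⟨ cong (t i +_) (sum-cong-≗ (λ j → t≡0 _ (punchInᵢ≢i i j))) ⟩
  t i + sum (replicate n 0ℤ)   ≡⟨ cong (t i +_) (sum-replicate-zero n) ⟩
  t i + 0ℤ                     ≡⟨ ℤₚ.+-identityʳ (t i) ⟩
  t i                          ∎
  where open ≡-Reasoning

i-j≡k⇒i≡j+k : ∀ i j {k} → i - j ≡ k → i ≡ j + k
i-j≡k⇒i≡j+k i j refl = lemma i j
  where
  lemma : ∀ i j → i ≡ j + (i - j)
  lemma = solve-∀

module _ {n} (G : EdgeLabeledGraph n) (m : Fin n → ℤ) where

  combination : ∀ {k} → (Fin k → ℤ) → (Fin k → Spline G m) → Spline G m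
  combination = linearCombination (R̂ G m)

  entry-combination : ∀ {k} (c : Fin k → ℤ) (F : Fin k → Spline G m) v →
    entry (combination c F) v ≡ sum (λ j → c j * entry (F j) v)
  entry-combination {ℕ.zero}  c F v = refl
  entry-combination {ℕ.suc k} c F v =
    cong (c zero * entry (F zero) v +_) (entry-combination (c ∘ suc) (F ∘ suc) v)

  -- The new coefficients are `c` plus `δ`, which is `q` at `i` and zero elsewhere. The sum splits
  -- accordingly, and its second half collapses to one term.
  entry-combination-updateAt : ∀ {k} (c : Fin k → ℤ) (F : Fin k → Spline G m) i q v →
    entry (combination (updateAt c i (_+ q)) F) v ≡ entry (combination c F) v + q * entry (F i) v
  entry-combination-updateAt {k} c F i q v = begin
    entry (combination (updateAt c i (_+ q)) F) v         ≡⟨ entry-combination (updateAt c i (_+ q)) F v ⟩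
    sum (λ j → updateAt c i (_+ q) j * entry (F j) v)     ≡⟨ sum-cong-≗ split ⟩
    sum (λ j → c j * entry (F j) v + δ j * entry (F j) v) ≡⟨ ∑-distrib-+ (λ j → c j * entry (F j) v) _ ⟩
    sum (λ j → c j * entry (F j) v) + sum (λ j → δ j * entry (F j) v)
      ≡⟨ cong₂ _+_ (sym (entry-combination c F v)) (sum-single _ i off-i) ⟩
    entry (combination c F) v + δ i * entry (F i) v       ≡⟨ cong (λ d → entry (combination c F) v + d * entry (F i) v) (updateAt-updates i zeros) ⟩
    entry (combination c F) v + q * entry (F i) v         ∎
    where
    open ≡-Reasoning
    zeros δ : Fin k → ℤ
    zeros = replicate k 0ℤ
    δ = updateAt zeros i (const q)

    off-i : ∀ j → j ≢ i → δ j * entry (F j) v ≡ 0ℤ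
    -- A product with left factor `0ℤ` computes to `0ℤ`, so `cong` alone suffices.
    off-i j j≢i = cong (_* entry (F j) v) (updateAt-minimal j i zeros j≢i)

    coefficient : ∀ j → updateAt c i (_+ q) j ≡ c j + δ j
    coefficient j with j ≟ i
    ... | yes refl = trans (updateAt-updates i c) (cong (c i +_) (sym (updateAt-updates i zeros)))
    ... | no  j≢i  = trans (updateAt-minimal j i c j≢i)
      (sym (trans (cong (c j +_) (updateAt-minimal j i zeros j≢i)) (ℤₚ.+-identityʳ (c j))))

    split : ∀ j → updateAt c i (_+ q) j * entry (F j) v ≡ c j * entry (F j) v + δ j * entry (F j) v
    split j = trans (cong (_* entry (F j) v) (coefficient j)) (ℤₚ.*-distribʳ-+ (entry (F j) v) (c j) (δ j))

  module FlowUp (F : Fin n → Spline G m) (F∈𝓕̂ : ∀ i → F i ∈ 𝓕̂ G m i) where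

    leading≢0 : ∀ i → entry (F i) i ≢ 0ℤ
    leading≢0 i with nz , _ ← F∈𝓕̂ i = nz

    before≡0 : ∀ i {s} → s < i → entry (F i) s ≡ 0ℤ
    before≡0 i {s} s<i with _ , z ← F∈𝓕̂ i = z s s<i

    -- Only the term at `i` survives: earlier terms have zero coefficient, and each later `F j`
    -- vanishes at `i`, which lies before `j`.
    entry-combination-leading : ∀ c i → (∀ j → j < i → c j ≡ 0ℤ) →
      entry (combination c F) i ≡ c i * entry (F i) i
    entry-combination-leading c i c≡0 = trans (entry-combination c F i) (sum-single _ i off-i)
      where
      off-i : ∀ j → j ≢ i → c j * entry (F j) i ≡ 0ℤ
      off-i j j≢i with <-cmp j i
      ... | tri< j<i _ _ = cong (_* entry (F j) i) (c≡0 j j<i)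
      ... | tri≈ _ j≡i _ = contradiction j≡i j≢i
      ... | tri> _ _ i<j = trans (cong (c j *_) (before≡0 j i<j)) (ℤₚ.*-zeroʳ (c j))

    -- Well-founded induction on `j`: once the earlier coefficients are zero, the entry at `j` is
    -- `c j` times a nonzero leading entry, and ℤ has no zero divisors. Assuming zeros only up to
    -- `j` lets the lemma serve flow-up classes as well as independence.
    coefficient≡0 : ∀ c j → (∀ v → v ≤ j → entry (combination c F) v ≡ 0ℤ) → c j ≡ 0ℤ
    coefficient≡0 c j = go j (<-wellFounded j)
      where
      go : ∀ j → Acc _<_ j → (∀ v → v ≤ j → entry (combination c F) v ≡ 0ℤ) → c j ≡ 0ℤ
      go j (acc rs) vanishes
        with ℤₚ.i*j≡0⇒i≡0∨j≡0 (c j)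
               (trans (sym (entry-combination-leading c j
                 (λ i i<j → go i (rs i<j) (λ v v≤i → vanishes v (ℕₚ.≤-trans v≤i (ℕₚ.<⇒≤ i<j))))))
                 (vanishes j ℕₚ.≤-refl))
      ... | inj₁ cj≡0 = cj≡0
      ... | inj₂ l≡0  = contradiction l≡0 (leading≢0 j)

    linearlyIndependent : LinearlyIndependent (R̂ G m) F
    linearlyIndependent c comb≈0 j = coefficient≡0 c j (λ v _ → comb≈0 v)

    LeadingEntriesDivide : Set
    LeadingEntriesDivide = ∀ i (A : Spline G m) → A ∈ 𝓕̂ G m i → entry (F i) i ∣ entry A i

    -- The quotient is the coefficient `c i` in an expansion of `A`: the zeros of `A` before `i`
    -- force the earlier coefficients to vanish.
    spanning⇒divide : Spanning (R̂ G m) F → LeadingEntriesDivide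
    spanning⇒divide span i A (_ , A≡0) with c , A≈comb ← span A =
      divides (c i) (trans (A≈comb i) (entry-combination-leading c i c≡0))
      where
      c≡0 : ∀ j → j < i → c j ≡ 0ℤ
      c≡0 j j<i = coefficient≡0 c j
        (λ v v≤j → trans (sym (A≈comb v)) (A≡0 v (ℕₚ.≤-<-trans v≤j j<i)))

    module _ (divide : LeadingEntriesDivide) where

      -- A remainder in the elimination may also vanish at `i`. It is then no `i`-th flow-up class,
      -- but zero is divisible by anything.
      divide-vanishing : ∀ i (A : Spline G m) → (∀ s → s < i → entry A s ≡ 0ℤ) →
        entry (F i) i ∣ entry A i
      divide-vanishing i A A≡0 with entry A i ℤₚ.≟ 0ℤ
      ... | yes Ai≡0 = divides 0ℤ Ai≡0
      ... | no  Ai≢0 = divide i A (Ai≢0 , A≡0)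

      -- The elimination invariant after `k` steps. The bound is a natural number rather than a
      -- `Fin n` so that `k` can reach `n`, where agreement holds at every vertex.
      agree-below : ∀ x k → k ℕ.≤ n →
        ∃ λ c → ∀ v → toℕ v ℕ.< k → entry x v ≡ entry (combination c F) v
      agree-below x ℕ.zero    _   = replicate n 0ℤ , λ _ ()
      agree-below x (ℕ.suc k) k<n = extend (agree-below x k (ℕₚ.<⇒≤ k<n))
        where
        i : Fin n
        i = fromℕ< k<n

        extend : (∃ λ c → ∀ v → toℕ v ℕ.< k → entry x v ≡ entry (combination c F) v) →
          ∃ λ c → ∀ v → toℕ v ℕ.< ℕ.suc k → entry x v ≡ entry (combination c F) v
        -- The invariant says nothing about the value of `c i`, so `q` is added to it instead of
        -- replacing it.
        extend (c , agree) = updateAt c i (_+ q) ,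
          λ v v≤k → trans (agree′ v (ℕₚ.m<1+n⇒m<n∨m≡n v≤k)) (sym (entry-combination-updateAt c F i q v))
          where
          open LeftModule (R̂ G m) using (_+ᴹ_; -ᴹ_)

          remainder : Spline G m
          remainder = x +ᴹ (-ᴹ combination c F)

          i∣remainder : entry (F i) i ∣ entry remainder i
          -- Since `toℕ i` is `k`, agreement below `k` makes the remainder vanish before `i`.
          i∣remainder = divide-vanishing i remainder λ s s<i →
            ℤₚ.i≡j⇒i-j≡0 (agree s (subst (toℕ s ℕ.<_) (toℕ-fromℕ< k<n) s<i))

          open _∣_ i∣remainder renaming (quotient to q; equality to remainder≡)

          agree′ : ∀ v → toℕ v ℕ.< k ⊎ toℕ v ≡ k →
            entry x v ≡ entry (combination c F) v + q * entry (F i) v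
          -- The correction by `F i` is zero before `i`, so earlier agreement is kept.
          agree′ v (inj₁ v<k) = begin
            entry x v                                      ≡⟨ agree v v<k ⟩
            entry (combination c F) v                      ≡⟨ ℤₚ.+-identityʳ _ ⟨
            entry (combination c F) v + 0ℤ                 ≡⟨ cong (entry (combination c F) v +_) (ℤₚ.*-zeroʳ q) ⟨
            entry (combination c F) v + q * 0ℤ             ≡⟨ cong (λ t → entry (combination c F) v + q * t) (before≡0 i v<i) ⟨
            entry (combination c F) v + q * entry (F i) v  ∎
            where
            open ≡-Reasoning
            v<i : v < i
            v<i = subst (toℕ v ℕ.<_) (sym (toℕ-fromℕ< k<n)) v<k
          -- Here `v` is `i`, and `q` was chosen so that `q * entry (F i) i` is exactly the
          -- remaining difference.
          agree′ v (inj₂ v≡k) with refl ← toℕ-injective {i = v} {j = i} (trans v≡k (sym (toℕ-fromℕ< k<n))) =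
            i-j≡k⇒i≡j+k (entry x i) (entry (combination c F) i) remainder≡

      spanning : Spanning (R̂ G m) F
      spanning x with c , agree ← agree-below x n ℕₚ.≤-refl = c , λ v → agree v (toℕ<n v)

theorem4p1 : ∀ (n : ℕ) (G : EdgeLabeledGraph n) (m : Fin n → ℤ)
    (F : Fin n → Spline G m) → (∀ i → F i ∈ 𝓕̂ G m i) →
    IsBasis (R̂ G m) F ⇔
    (∀ i (A : Spline G m) → A ∈ 𝓕̂ G m i → entry (F i) i ∣ entry A i)
theorem4p1 n G m F F∈𝓕̂ = mk⇔
  (λ (_ , span) → spanning⇒divide span)
  (λ divide → linearlyIndependent , spanning divide)
  where open FlowUp G m F F∈𝓕̂
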